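{- Every biconvex graph $G$ with bipartition $(A,B)$ has a proper conflict-free $6$-coloring $c$ such that $|c(A)|\le 3$ and $|c(B)|\le 3$.
   Context: Graphs are finite and simple. A bipartite graph with bipartition $(A,B)$ is biconvex if there is a linear order of $A$ such that for every $w\in B$ the vertices of $N(w)$ appear consecutively in it, and there is a linear order of $B$ such that for every $w\in A$ the vertices of $N(w)$ appear consecutively in it. A proper conflict-free $k$-coloring of $G$ is a proper vertex coloring with at most $k$ colors in which, for every non-isolated vertex $v$, some color appears exactly once in the open neighborhood $N(v)$. $c(Z)$ denotes the set of colors used by $c$ on a vertex set $Z$. -}

module Defs where

open import Data.Bool.Properties using (T-≡)
open import Data.Fin using (Fin)
open import Data.Fin.Properties using (_≟_; any?)
open import Data.Fin.Subset using (Subset; _∈_; _∉_)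
open import Data.Fin.Subset.Properties using (_∈?_)
open import Data.Nat using (ℕ)
open import Data.Product using (∃; ∃!; ∃-syntax; _×_; proj₁)
open import Data.Sum using (_⊎_)
open import Data.Vec using (tabulate)
open import Data.Vec.Properties using (lookup∘tabulate; []=⇒lookup; lookup⇒[]=)
open import Function using (_⇔_; mk⇔; Equivalence)
open import Level using (0ℓ; suc)
open import Relation.Binary using (Rel; Decidable; Symmetric; IsTotalOrder)
open import Relation.Binary.PropositionalEquality using (_≡_; _≢_; sym; trans)
open import Relation.Nullary using (¬_; Dec)
open import Relation.Nullary.Decidable using (_×-dec_; isYes; toWitness; fromWitness)

record Graph (n : ℕ) : Set (suc 0ℓ) where
  field
    Adj      : Rel (Fin n) 0ℓ
    adj?     : Decidable Adj
    adj-sym  : Symmetric Adj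
    adj-irr  : ∀ v → ¬ Adj v v

record IsBipartition {n} (G : Graph n) (A B : Subset n) : Set where
  open Graph G
  field
    cover    : ∀ v → v ∈ A ⊎ v ∈ B
    disjoint : ∀ v → v ∈ A → v ∉ B
    crossing : ∀ u v → Adj u v → (u ∈ A × v ∈ B) ⊎ (u ∈ B × v ∈ A)

-- Proofs of v ∈ X are unique, so propositional equality of elements is
-- equality of the underlying vertices.
Elem : ∀ {n} → Subset n → Set
Elem X = ∃ λ v → v ∈ X

-- The vertices of N(w) in X appear consecutively in _≤_: no element of X
-- outside N(w) lies between two elements of N(w).
Consecutive : ∀ {n} (G : Graph n) (X : Subset n) → Rel (Elem X) 0ℓ → Fin n → Set
Consecutive G X _≤_ w =
  ∀ (x y z : Elem X) → x ≤ y → y ≤ z →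
  Adj w (proj₁ x) → Adj w (proj₁ z) → Adj w (proj₁ y)
  where open Graph G

-- Totality and antisymmetry make _≤_ decidable here, because equality of
-- vertices is decidable.
record ConvexOrder {n} (G : Graph n) (X Y : Subset n) : Set (suc 0ℓ) where
  field
    _≤_          : Rel (Elem X) 0ℓ
    isTotalOrder : IsTotalOrder _≡_ _≤_
    consecutive  : ∀ w → w ∈ Y → Consecutive G X _≤_ w

record IsBiconvex {n} (G : Graph n) (A B : Subset n) : Set (suc 0ℓ) where
  field
    bipartition : IsBipartition G A B
    convexA     : ConvexOrder G A B
    convexB     : ConvexOrder G B A

-- Colors in Fin k need not all be used, so this is "at most k colors".
record IsProperConflictFree {n k} (G : Graph n) (c : Fin n → Fin k) : Set where
  open Graph G
  field
    proper       : ∀ u v → Adj u v → c u ≢ c v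
    conflictFree : ∀ v → ∃ (Adj v) →
                   ∃[ i ] ∃! _≡_ (λ u → Adj v u × c u ≡ i)

usedOn? : ∀ {n k} (c : Fin n → Fin k) (Z : Subset n) (i : Fin k) →
          Dec (∃ λ v → v ∈ Z × c v ≡ i)
usedOn? c Z i = any? (λ v → (v ∈? Z) ×-dec (c v ≟ i))

image : ∀ {n k} → (Fin n → Fin k) → Subset n → Subset k
image c Z = tabulate (λ i → isYes (usedOn? c Z i))

∈-image : ∀ {n k} (c : Fin n → Fin k) (Z : Subset n) (i : Fin k) →
          i ∈ image c Z ⇔ (∃ λ v → v ∈ Z × c v ≡ i)
∈-image c Z i = mk⇔
  (λ p → toWitness {a? = usedOn? c Z i} (Equivalence.from T-≡
           (trans (sym (lookup∘tabulate _ i)) ([]=⇒lookup p))))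
  (λ e → lookup⇒[]= i (image c Z) (trans (lookup∘tabulate _ i)
           (Equivalence.to T-≡ (fromWitness {a? = usedOn? c Z i} e))))

{-# OPTIONS --safe #-}
-- Let (X , ≤) be the ordered side. Each vertex v of the other side covers the
-- interval N(v) of X. Sweeping X from its least vertex h upwards, pick a
-- neighbor x of h whose interval reaches furthest, and go on behind that
-- interval. Every non-isolated vertex of X is adjacent to one or two of the
-- picked vertices, and if to two, then to consecutively picked ones. So giving
-- the picked vertices two colors alternately, and all other vertices a third
-- color, gives each non-isolated vertex of X a color that is unique in its
-- neighborhood. Doing this for both sides with disjoint palettes gives the
-- coloring. Each side is colored using the order of the opposite side only.
module Submission where

open import Defs
open import Data.Fin using (Fin; _↑ˡ_; _↑ʳ_)
open import Data.Fin.Patterns using (0F; 1F; 2F)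
open import Data.Fin.Properties using (_≟_; any?; ↑ˡ-injective; ↑ʳ-injective)
open import Data.Fin.Subset using (Subset; ∣_∣; _∈_; _⊆_; inside; outside)
open import Data.Fin.Subset.Properties using (_∈?_; p⊆q⇒∣p∣≤∣q∣)
open import Data.List using (List; []; _∷_; _++_; length; allFin; concatMap)
open import Data.List.Membership.Propositional as List using ()
open import Data.List.Membership.Propositional.Properties
  using (∈-allFin; ∈-concatMap⁺)
open import Data.List.Properties using (length-++)
open import Data.List.Relation.Binary.Permutation.Propositional using (↭-sym)
open import Data.List.Relation.Binary.Permutation.Propositional.Properties
  using (∈-resp-↭)
open import Data.List.Relation.Unary.All as All using (All; []; _∷_)
import Data.List.Relation.Unary.All.Properties as All
open import Data.List.Relation.Unary.AllPairs using (AllPairs; []; _∷_)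
open import Data.List.Relation.Unary.Any as Any using (Any; here; there)
import Data.List.Relation.Unary.Any.Properties as Any
open import Data.List.Relation.Unary.Linked.Properties using (Linked⇒AllPairs)
import Data.List.Sort as Sort
open import Data.Nat using (ℕ; _≤_; _<_; s≤s)
open import Data.Nat.Induction using (<-wellFounded)
open import Data.Nat.Properties using (m≤n+m; ≤-refl; ≤-reflexive; ≤-trans)
open import Data.Product
  using (Σ-syntax; ∃; ∃-syntax; _×_; _,_; proj₁; proj₂)
open import Data.Sum using (inj₁; inj₂)
open import Data.Vec using ([]; _∷_; here; there)
open import Data.Vec.Functional using (updateAt)
open import Data.Vec.Functional.Properties using (updateAt-updates; updateAt-minimal)
open import Function using (const; case_of_; Equivalence)
open import Induction.WellFounded using (Acc; acc)
open import Level using (0ℓ)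
open import Relation.Binary using (Rel; Decidable; DecidableEquality; DecTotalOrder; IsTotalOrder)
open import Relation.Binary.PropositionalEquality
  using (_≡_; _≢_; refl; sym; trans; cong; subst)
open import Relation.Nullary using (¬_; Dec; yes; no; contradiction)
open import Relation.Nullary.Decidable using (_×-dec_; map′)

-- Greedy sweep over an abstract system of intervals.

UniqueColor : ∀ {n k} → (Fin n → Fin k) → (Fin n → Set) → Set
UniqueColor c P = ∃[ x ] P x × (∀ y → P y → c y ≡ c x → y ≡ x)

-- With `0F` reserved for unpicked vertices, this exchanges `1F` and `2F` and so produces the
-- alternation.
another : ∀ (i : Fin 3) → ∃[ j ] j ≢ 0F × j ≢ i
another 0F = 1F , (λ ()) , (λ ())
another 1F = 2F , (λ ()) , (λ ())
another 2F = 1F , (λ ()) , (λ ())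

module Sweep {X : Set} (_≼_ : Rel X 0ℓ) {n : ℕ} (R : Fin n → X → Set)
  (R? : ∀ v b → Dec (R v b))
  (convex : ∀ v {x y z} → x ≼ y → y ≼ z → R v x → R v z → R v y) where

  Disjoint : X → X → Set
  Disjoint a b = ∀ v → R v a → ¬ R v b

  -- The list is searched from its far end. Once some `x` covers `h` and an element behind `b`,
  -- convexity makes it cover `b` too.
  furthest : ∀ {h x} → R x h → ∀ L → All (h ≼_) L → AllPairs _≼_ L →
             ∃[ x′ ] ∃[ pre ] ∃[ post ]
               L ≡ pre ++ post × R x′ h × All (R x′) pre × All (Disjoint h) post
  furthest {x = x} Rxh [] _ _ = x , [] , [] , refl , Rxh , [] , []
  furthest {h} Rxh (b ∷ L) (h≼b ∷ h≼L) (b≼L ∷ sorted)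
    with furthest Rxh L h≼L sorted
  ... | x , a ∷ pre , post , refl , Rxh′ , Rxa ∷ Rxpre , disj =
    x , b ∷ a ∷ pre , post , refl , Rxh′ ,
    convex x h≼b (All.head b≼L) Rxh′ Rxa ∷ Rxa ∷ Rxpre , disj
  ... | _ , [] , _ , refl , _ , _ , disj
    -- Nothing behind `b` shares a neighbor with `h`, so `b` decides whether the reach of `h` ends
    -- here or in front of it.
    with any? (λ v → R? v h ×-dec R? v b)
  ... | yes (x , Rxh′ , Rxb) = x , b ∷ [] , L , refl , Rxh′ , Rxb ∷ [] , disj
  ... | no ∄v = _ , [] , b ∷ L , refl , Rxh , [] ,
                (λ v Rvh Rvb → ∄v (v , Rvh , Rvb)) ∷ disj

  -- Color 0F marks the vertices that were not picked. The color free is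
  -- available for the vertex picked just before the sweep enters L.
  record Sweeping (L : List X) : Set where
    field
      color     : Fin n → Fin 3
      picked    : ∀ v → color v ≢ 0F → Any (R v) L
      unique    : All (λ b → ∃[ v ] R v b → UniqueColor color (λ v → R v b)) L
      free      : Fin 3
      free≢0    : free ≢ 0F
      available : ∀ b v → All (b ≼_) L → R v b → color v ≢ free

  -- The recursion may skip all of `pre`, hence the induction on length.
  sweep-acc : ∀ L → AllPairs _≼_ L → Acc _<_ (length L) → Sweeping L
  sweep-acc [] _ _ = record
    { color     = const 0F
    ; picked    = λ _ 0≢0 → contradiction refl 0≢0
    ; unique    = []
    ; free      = 1F
    ; free≢0    = λ ()
    ; available = λ _ _ _ _ ()
    }
  sweep-acc (h ∷ L) (h≼L ∷ sorted) (acc rec) with any? (λ v → R? v h)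
  ... | no ∄v = record
    { color     = color
    ; picked    = λ v v≢0 → there (picked v v≢0)
    ; unique    = (λ e → contradiction e ∄v) ∷ unique
    ; free      = free
    ; free≢0    = free≢0
    ; available = λ b v b≼ → available b v (All.tail b≼)
    }
    where open Sweeping (sweep-acc L sorted (rec (s≤s ≤-refl)))
  ... | yes (_ , Rh) with furthest Rh L h≼L sorted
  ... | x , pre , post , refl , Rxh , Rxpre , disj = record
    { color     = color′
    ; picked    = picked′
    ; unique    = (λ _ → unique-x Rxh (All.++⁻ʳ pre h≼L))
                  ∷ All.++⁺ (unique-pre Rxpre sorted)
                            (All.zipWith (λ (d , u) → unique-post d u) (disj , unique))
    ; free      = free′
    ; free≢0    = proj₁ (proj₂ (another free))
    ; available = available′
    }
    where
    sorted-post : ∀ pre → AllPairs _≼_ (pre ++ post) → AllPairs _≼_ post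
    sorted-post []        s       = s
    sorted-post (_ ∷ pre) (_ ∷ s) = sorted-post pre s

    open Sweeping (sweep-acc post (sorted-post pre sorted)
      (rec (s≤s (≤-trans (m≤n+m _ (length pre)) (≤-reflexive (sym (length-++ pre)))))))

    free′ : Fin 3
    free′ = proj₁ (another free)

    color′ : Fin n → Fin 3
    color′ = updateAt color x (const free)

    color′-x : color′ x ≡ free
    color′-x = updateAt-updates x color

    color′-≢x : ∀ {v} → v ≢ x → color′ v ≡ color v
    color′-≢x {v} = updateAt-minimal v x color

    picked′ : ∀ v → color′ v ≢ 0F → Any (R v) (h ∷ pre ++ post)
    picked′ v v≢0 with v ≟ x
    ... | yes refl = here Rxh
    ... | no v≢x = there (Any.++⁺ʳ pre
                     (picked v (λ eq → v≢0 (trans (color′-≢x v≢x) eq))))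

    -- By `available`, the coloring of `post` gives `free` to no neighbor of `b`, so only the newly
    -- colored `x` has it. This serves `h` and all of `pre`.
    unique-x : ∀ {b} → R x b → All (b ≼_) post → UniqueColor color′ (λ v → R v b)
    unique-x {b} Rxb b≼post = x , Rxb , only
      where
      only : ∀ y → R y b → color′ y ≡ color′ x → y ≡ x
      only y Ryb eq with y ≟ x
      ... | yes y≡x = y≡x
      ... | no y≢x = contradiction
        (trans (sym (color′-≢x y≢x)) (trans eq color′-x)) (available b y b≼post Ryb)

    unique-pre : ∀ {pre} → All (R x) pre → AllPairs _≼_ (pre ++ post) →
                 All (λ b → ∃[ v ] R v b → UniqueColor color′ (λ v → R v b)) pre
    unique-pre [] _ = []
    unique-pre {_ ∷ pre} (Rxb ∷ Rxpre) (b≼ ∷ s) =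
      (λ _ → unique-x Rxb (All.++⁻ʳ pre b≼)) ∷ unique-pre Rxpre s

    -- Since `x` covers `h`, it cannot cover `b`, so recoloring `x` leaves the neighborhood of `b`
    -- untouched.
    unique-post : ∀ {b} → Disjoint h b →
                  (∃[ v ] R v b → UniqueColor color (λ v → R v b)) →
                  ∃[ v ] R v b → UniqueColor color′ (λ v → R v b)
    unique-post {b} d u e with u e
    ... | z , Rzb , only = z , Rzb , λ y Ryb eq →
      only y Ryb (trans (sym (color′-≢x (≢x Ryb))) (trans eq (color′-≢x (≢x Rzb))))
      where
      ≢x : ∀ {v} → R v b → v ≢ x
      ≢x Rvb refl = d x Rxh Rvb

    -- The vertex `x` has color `free`. Any other `v` colored `free′` was picked for `post`, so it
    -- covers some `d` there. As `b ≼ h ≼ d`, it covers `h` as well, against the disjointness of `h`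
    -- and `d`.
    available′ : ∀ b v → All (b ≼_) (h ∷ pre ++ post) → R v b → color′ v ≢ free′
    available′ b v (b≼h ∷ _) Rvb eq with v ≟ x
    ... | yes refl = proj₂ (proj₂ (another free)) (trans (sym eq) color′-x)
    ... | no v≢x = All.lookupWith
      (λ (h≼d , disj-d) Rvd → disj-d v (convex v b≼h h≼d Rvb Rvd) Rvd)
      (All.zip (All.++⁻ʳ pre h≼L , disj))
      (picked v (λ v≡0 → proj₁ (proj₂ (another free))
        (trans (sym eq) (trans (color′-≢x v≢x) v≡0))))

  sweep : ∀ L → AllPairs _≼_ L → Sweeping L
  sweep L sorted = sweep-acc L sorted (<-wellFounded (length L))

-- Listing the ordered side in increasing order.

∈-irrelevant : ∀ {n} {X : Subset n} {v} (p q : v ∈ X) → p ≡ q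
∈-irrelevant here      here      = refl
∈-irrelevant (there p) (there q) = cong there (∈-irrelevant p q)

module _ {n : ℕ} (X : Subset n) where

  _≟ᴱ_ : DecidableEquality (Elem X)
  (u , p) ≟ᴱ (v , q) =
    map′ (λ { refl → cong (u ,_) (∈-irrelevant p q) }) (cong proj₁) (u ≟ v)

  elemAt : Fin n → List (Elem X)
  elemAt v with v ∈? X
  ... | yes p = (v , p) ∷ []
  ... | no _  = []

  ∈-elemAt : ∀ {v} (p : v ∈ X) → (v , p) List.∈ elemAt v
  ∈-elemAt {v} p with v ∈? X
  ... | yes q  = here (cong (v ,_) (∈-irrelevant p q))
  ... | no v∉X = contradiction p v∉X

  elems : List (Elem X)
  elems = concatMap elemAt (allFin n)

  ∈-elems : ∀ b → b List.∈ elems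
  ∈-elems (v , p) =
    ∈-concatMap⁺ elemAt (Any.map (λ { refl → ∈-elemAt p }) (∈-allFin v))

  sortedElems : ∀ {_≼_ : Rel (Elem X) 0ℓ} → IsTotalOrder _≡_ _≼_ →
                ∃[ L ] AllPairs _≼_ L × (∀ b → b List.∈ L)
  sortedElems {_≼_} isTotalOrder =
    sort elems , Linked⇒AllPairs ≼.trans (sort-↗ elems) ,
    λ b → ∈-resp-↭ (↭-sym (sort-↭ elems)) (∈-elems b)
    where
    module ≼ = IsTotalOrder isTotalOrder

    _≼?_ : Decidable _≼_
    a ≼? b with ≼.total a b
    ... | inj₁ a≼b = yes a≼b
    -- Given `b ≼ a`, antisymmetry reduces `a ≼ b` to equality.
    ... | inj₂ b≼a = map′ ≼.reflexive (λ a≼b → ≼.antisym a≼b b≼a) (a ≟ᴱ b)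

    decTotalOrder : DecTotalOrder 0ℓ 0ℓ 0ℓ
    decTotalOrder = record
      { isDecTotalOrder = record
        { isTotalOrder = isTotalOrder ; _≟_ = _≟ᴱ_ ; _≤?_ = _≼?_ } }

    open Sort decTotalOrder using (sort; sort-↗; sort-↭)

-- Coloring one side of the graph.

module _ {n : ℕ} (G : Graph n) where
  open Graph G

  neighborhoodColoring : ∀ {X Y} → ConvexOrder G X Y →
    (∀ {u v} → Adj u v → v ∈ X → u ∈ Y) →
    ∃[ c ] (∀ v → v ∈ X → ∃ (Adj v) → UniqueColor {k = 3} c (Adj v))
  neighborhoodColoring {X} order other =
    Sweeping.color s , λ v v∈X (u , v~u) →
      case All.lookup (Sweeping.unique s) (complete (v , v∈X)) (u , adj-sym v~u) of
        λ (x , x~v , only) → x , adj-sym x~v , λ y v~y → only y (adj-sym v~y)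
    where
    open ConvexOrder order renaming (_≤_ to _≼_)

    sorted   = sortedElems X isTotalOrder
    complete = proj₂ (proj₂ sorted)

    open Sweep _≼_ (λ v b → Adj v (proj₁ b)) (λ v b → adj? v (proj₁ b))
      -- A vertex with a neighbor in `X` lies in `Y`, where convexity is given.
      (λ v {x} {y} {z} x≼y y≼z v~x v~z →
         consecutive v (other v~x (proj₂ x)) x y z x≼y y≼z v~x v~z)

    s = sweep (proj₁ sorted) (proj₁ (proj₂ sorted))

-- Disjoint palettes and the combined coloring.

lowerHalf upperHalf : Subset 6
lowerHalf = inside ∷ inside ∷ inside ∷ outside ∷ outside ∷ outside ∷ []
upperHalf = outside ∷ outside ∷ outside ∷ inside ∷ inside ∷ inside ∷ []

∈-lowerHalf : ∀ (i : Fin 3) → i ↑ˡ 3 ∈ lowerHalf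
∈-lowerHalf 0F = here
∈-lowerHalf 1F = there here
∈-lowerHalf 2F = there (there here)

∈-upperHalf : ∀ (i : Fin 3) → 3 ↑ʳ i ∈ upperHalf
∈-upperHalf 0F = there (there (there here))
∈-upperHalf 1F = there (there (there (there here)))
∈-upperHalf 2F = there (there (there (there (there here))))

lower≢upper : ∀ (i j : Fin 3) → i ↑ˡ 3 ≢ 3 ↑ʳ j
lower≢upper 0F _ ()
lower≢upper 1F _ ()
lower≢upper 2F _ ()

image⊆ : ∀ {n k} (c : Fin n → Fin k) (Z : Subset n) {P : Subset k} →
         (∀ v → v ∈ Z → c v ∈ P) → image c Z ⊆ P
image⊆ c Z {P} into {i} i∈ with Equivalence.to (∈-image c Z i) i∈
... | v , v∈Z , refl = into v v∈Z

lemma1p6 : ∀ (n : ℕ) (G : Graph n) (A B : Subset n) → IsBiconvex G A B →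
    Σ[ c ∈ (Fin n → Fin 6) ]
    IsProperConflictFree G c × ∣ image c A ∣ ≤ 3 × ∣ image c B ∣ ≤ 3
lemma1p6 n G A B biconvex =
  c , record { proper = proper ; conflictFree = conflictFree } ,
  -- Each palette has three elements, which bounds the image inside it.
  p⊆q⇒∣p∣≤∣q∣ (image⊆ c A {lowerHalf} λ v v∈A →
    subst (_∈ lowerHalf) (sym (c-A v∈A)) (∈-lowerHalf (cA v))) ,
  p⊆q⇒∣p∣≤∣q∣ (image⊆ c B {upperHalf} λ v v∈B →
    subst (_∈ upperHalf) (sym (c-B v∈B)) (∈-upperHalf (cB v)))
  where
  open Graph G
  open IsBiconvex biconvex
  open IsBipartition bipartition

  A→B : ∀ {u v} → Adj u v → u ∈ A → v ∈ B
  A→B {u} {v} u~v u∈A with crossing u v u~v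
  ... | inj₁ (_ , v∈B) = v∈B
  ... | inj₂ (u∈B , _) = contradiction u∈B (disjoint u u∈A)

  B→A : ∀ {u v} → Adj u v → u ∈ B → v ∈ A
  B→A {u} {v} u~v u∈B with crossing u v u~v
  ... | inj₁ (u∈A , _) = contradiction u∈B (disjoint u u∈A)
  ... | inj₂ (_ , v∈A) = v∈A

  -- The neighborhoods of vertices of `B` lie in `A`, so the order of `B` governs the colors on `A`.
  coloringA = neighborhoodColoring G convexB (λ u~v → B→A (adj-sym u~v))
  coloringB = neighborhoodColoring G convexA (λ u~v → A→B (adj-sym u~v))

  cA cB : Fin n → Fin 3
  cA = proj₁ coloringA
  cB = proj₁ coloringB

  c : Fin n → Fin 6
  c v with v ∈? A
  ... | yes _ = cA v ↑ˡ 3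
  ... | no _  = 3 ↑ʳ cB v

  c-A : ∀ {v} → v ∈ A → c v ≡ cA v ↑ˡ 3
  c-A {v} v∈A with v ∈? A
  ... | yes _  = refl
  ... | no v∉A = contradiction v∈A v∉A

  c-B : ∀ {v} → v ∈ B → c v ≡ 3 ↑ʳ cB v
  c-B {v} v∈B with v ∈? A
  ... | yes v∈A = contradiction v∈B (disjoint v v∈A)
  ... | no _    = refl

  proper : ∀ u v → Adj u v → c u ≢ c v
  proper u v u~v eq with crossing u v u~v
  ... | inj₁ (u∈A , v∈B) =
    lower≢upper (cA u) (cB v) (trans (sym (c-A u∈A)) (trans eq (c-B v∈B)))
  ... | inj₂ (u∈B , v∈A) =
    lower≢upper (cA v) (cB u) (trans (sym (c-A v∈A)) (trans (sym eq) (c-B u∈B)))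

  conflictFree : ∀ v → ∃ (Adj v) → _
  conflictFree v e with cover v
  ... | inj₁ v∈A =
    -- All neighbors of `v` lie in `B`, where `c` is `cB` followed by an injection, so uniqueness
    -- carries over.
    let x , v~x , only = proj₂ coloringB v v∈A e
    in c x , x , (v~x , refl) , λ {y} (v~y , eq) → sym (only y v~y
         (↑ʳ-injective 3 _ _ (trans (sym (c-B (A→B v~y v∈A))) (trans eq (c-B (A→B v~x v∈A))))))
  ... | inj₂ v∈B =
    let x , v~x , only = proj₂ coloringA v v∈B e
    in c x , x , (v~x , refl) , λ {y} (v~y , eq) → sym (only y v~y
         (↑ˡ-injective 3 _ _ (trans (sym (c-A (B→A v~y v∈B))) (trans eq (c-A (B→A v~x v∈B))))))
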